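{- Let $G$ be a finite simple graph that is weakly claw-free. Then $\gamma_{Zg}(G)=\gamma_g(G)$ and $\gamma_{Zg}'(G)=\gamma_g'(G)$.
   Context: Graphs are finite and simple. $N(v)$ and $N[v]=N(v)\cup\{v\}$ denote the open and closed neighborhood of a vertex $v$. A vertex $w$ is the center of a claw if $w$ has three pairwise non-adjacent neighbors (i.e. $w$ is the degree-$3$ vertex of an induced $K_{1,3}$). A graph $G$ is weakly claw-free if every vertex $u\in V(G)$ has a neighbor that is not the center of a claw (in particular, $G$ has no isolated vertices). Games: two players, Dominator and Staller, alternately select vertices $v_1,v_2,\ldots$ of an isolate-free graph $G$. In the domination game the $i$-th move $v_i$ is legal if $N[v_i]\setminus\bigcup_{j=1}^{i-1}N[v_j]\neq\emptyset$. In the Z-domination game the $i$-th move $v_i$ is legal if $N(v_i)\setminus\bigcup_{j=1}^{i-1}N[v_j]\neq\emptyset$. Each game ends when no legal move is available. Dominator wants to minimize the total number of moves, Staller wants to maximize it. When both players play optimally, the total number of moves played (by both players) is, in the domination game, $\gamma_g(G)$ if Dominator moves first and $\gamma_g'(G)$ if Staller moves first; and in the Z-domination game, $\gamma_{Zg}(G)$ if Dominator moves first and $\gamma_{Zg}'(G)$ if Staller moves first. -}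

module Defs where

open import Data.Bool.Base using (true)
open import Data.Fin.Base using (Fin)
open import Data.Fin.Properties using (_≟_; any?)
open import Data.Fin.Subset using (Subset; _⊂_) renaming (_∈_ to _∈ₛ_)
open import Data.Fin.Subset.Induction using (⊂-wellFounded)
open import Data.List.Base using (List; []; _∷_; allFin; map; mapMaybe)
open import Data.List.NonEmpty.Base using (List⁺; foldr₁) renaming (_∷_ to _∷⁺_)
open import Data.List.Relation.Unary.Any as Any using (Any; here; there)
open import Data.Maybe.Base as Maybe using (Maybe)
open import Data.Nat.Base using (ℕ; suc; _⊓_; _⊔_)
open import Data.Product.Base using (∃; ∃-syntax; _×_; _,_)
open import Data.Sum.Base using (inj₁; inj₂)
open import Data.Vec.Base using (tabulate)
open import Data.Vec.Properties using (lookup∘tabulate; lookup⇒[]=; []=⇒lookup)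
open import Function.Base using (_∘_)
open import Induction.WellFounded using (Acc; acc; WellFounded; module Subrelation)
open import Level using (0ℓ)
import Relation.Binary.Construct.On as On
open import Relation.Binary.Core using (Rel)
open import Relation.Binary.Definitions using (Symmetric; Irreflexive)
  renaming (Decidable to Decidable₂)
open import Relation.Binary.PropositionalEquality using (_≡_; _≢_; refl; sym; trans)
open import Relation.Nullary using (¬_; Dec; yes; does)
open import Relation.Nullary.Decidable using (_×-dec_; _⊎-dec_; ¬?; dec⇒maybe; dec-true)
open import Relation.Unary using (Pred; Decidable; _∈_; _∉_; _∪_; _∖_; ｛_｝; Satisfiable)

record Graph (n : ℕ) : Set₁ where
  field
    Adj        : Rel (Fin n) 0ℓ
    adj?       : Decidable₂ Adj
    adj-sym    : Symmetric Adj
    adj-irrefl : Irreflexive _≡_ Adj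

module _ {n : ℕ} (G : Graph n) where
  open Graph G using (Adj)

  N : Fin n → Pred (Fin n) 0ℓ
  N v = Adj v

  N[_] : Fin n → Pred (Fin n) 0ℓ
  N[ v ] = N v ∪ ｛ v ｝

  ClawCenter : Pred (Fin n) 0ℓ
  ClawCenter w = ∃[ a ] ∃[ b ] ∃[ c ]
    (a ∈ N w × b ∈ N w × c ∈ N w) ×
    (a ≢ b × b ≢ c × a ≢ c) ×
    (¬ Adj a b × ¬ Adj b c × ¬ Adj a c)

  WeaklyClawFree : Set
  WeaklyClawFree = ∀ u → ∃[ w ] w ∈ N u × ¬ ClawCenter w

data Player : Set where
  dominator staller : Player

opponent : Player → Player
opponent dominator = staller
opponent staller   = dominator

data Variant : Set where
  domination Z-domination : Variant

module Game {n : ℕ} (G : Graph n) (V : Variant) where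
  open Graph G using (adj?)

  -- The moves played so far; their order is irrelevant to legality, and the
  -- most recent one comes first.
  History : Set
  History = List (Fin n)

  Dominated : History → Pred (Fin n) 0ℓ
  Dominated h u = Any (λ w → u ∈ N[_] G w) h

  Target : Variant → Fin n → Pred (Fin n) 0ℓ
  Target domination   v = N[_] G v
  Target Z-domination v = N G v

  Legal : History → Pred (Fin n) 0ℓ
  Legal h v = Satisfiable (Target V v ∖ Dominated h)

  N[_]? : ∀ v → Decidable (N[_] G v)
  N[ v ]? u = adj? v u ⊎-dec (v ≟ u)

  dominated? : ∀ h → Decidable (Dominated h)
  dominated? h u = Any.any? (λ w → N[ w ]? u) h

  target? : ∀ W v → Decidable (Target W v)
  target? domination   v u = N[ v ]? u
  target? Z-domination v u = adj? v u

  legal? : ∀ h → Decidable (Legal h)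
  legal? h v = any? λ u → target? V v u ×-dec ¬? (dominated? h u)

  legalMoves : ∀ h → List (∃ (Legal h))
  legalMoves h = mapMaybe (λ v → Maybe.map (v ,_) (dec⇒maybe (legal? h v))) (allFin n)

  -- h′ ⋖ h: the history h′ arises from h by one legal move.
  _⋖_ : Rel History 0ℓ
  h′ ⋖ h = ∃[ v ] Legal h v × h′ ≡ v ∷ h

  -- Every legal move strictly shrinks the set of undominated vertices, so play
  -- always terminates.
  undominated : History → Subset n
  undominated h = tabulate λ u → does (¬? (dominated? h u))

  ∈-undominated⁺ : ∀ h {u} → u ∉ Dominated h → u ∈ₛ undominated h
  ∈-undominated⁺ h {u} ¬d = lookup⇒[]= u _
    (trans (lookup∘tabulate _ u) (dec-true (¬? (dominated? h u)) ¬d))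

  ∈-undominated⁻ : ∀ h {u} → u ∈ₛ undominated h → u ∉ Dominated h
  ∈-undominated⁻ h {u} u∈ = from (¬? (dominated? h u))
      (trans (sym (lookup∘tabulate _ u)) ([]=⇒lookup u∈))
    where
    from : ∀ {A : Set} (A? : Dec A) → does A? ≡ true → A
    from (yes a) _ = a

  Target⊆N[] : ∀ W {v u} → u ∈ Target W v → u ∈ N[_] G v
  Target⊆N[] domination   u∈ = u∈
  Target⊆N[] Z-domination u∈ = inj₁ u∈

  ⋖⇒⊂ : ∀ {h′ h} → h′ ⋖ h → undominated h′ ⊂ undominated h
  ⋖⇒⊂ {h = h} (v , (u , u∈ , ¬d) , refl) =
    (λ x∈ → ∈-undominated⁺ h (∈-undominated⁻ (v ∷ h) x∈ ∘ there)) ,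
    u , ∈-undominated⁺ h ¬d ,
    λ u∈′ → ∈-undominated⁻ (v ∷ h) u∈′ (here (Target⊆N[] V u∈))

  ⋖-wellFounded : WellFounded _⋖_
  ⋖-wellFounded =
    Subrelation.wellFounded ⋖⇒⊂ (On.wellFounded undominated ⊂-wellFounded)

  best : Player → List⁺ ℕ → ℕ
  best dominator = foldr₁ _⊓_
  best staller   = foldr₁ _⊔_

  -- The game length for p to move, given the lengths remaining after each of
  -- p's legal moves; the game ends exactly when there are none.
  optimum : Player → List ℕ → ℕ
  optimum p []       = 0
  optimum p (k ∷ ks) = suc (best p (k ∷⁺ ks))

  -- The number of moves still to be played under optimal play from history h
  -- when p is to move.
  value : Player → (h : History) → Acc _⋖_ h → ℕ
  value p h (acc rs) = optimum p (map after (legalMoves h))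
    where
    after : ∃ (Legal h) → ℕ
    after (v , legal) = value (opponent p) (v ∷ h) (rs (v , legal , refl))

  gameNumber : Player → ℕ
  gameNumber p = value p [] (⋖-wellFounded [])

γg γg′ γZg γZg′ : ∀ {n} → Graph n → ℕ
γg   G = Game.gameNumber G domination   dominator
γg′  G = Game.gameNumber G domination   staller
γZg  G = Game.gameNumber G Z-domination dominator
γZg′ G = Game.gameNumber G Z-domination staller

{-# OPTIONS --safe #-}

-- A move v that is legal in the domination game but not in the Z-domination
-- game dominates exactly one new vertex, namely v itself.  Let w be a neighbour
-- of v that is not the centre of a claw.  Since w is already dominated while v
-- is not, w is adjacent to a played vertex x.  If w had a further undominated
-- neighbour u, then v, u and x would form a claw at w.  Hence v is the only
-- vertex newly dominated by w, and w is a legal Z-move with the same effect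
-- as v.  So in positions with the same dominated vertices the two games offer
-- the same options, and their values agree by induction.

module Submission where

open import Defs
open import Algebra.Definitions using (Associative; Commutative; Selective)
open import Data.Fin.Properties using (_≟_)
open import Data.List.Base using ([]; _∷_; map; allFin)
open import Data.List.Membership.Propositional using (find; lose) renaming (_∈_ to _∈ₗ_)
open import Data.List.Membership.Propositional.Properties using (∈-map⁺; ∈-map⁻; ∈-allFin)
open import Data.List.NonEmpty.Base using (foldr₁) renaming (_∷_ to _∷⁺_)
open import Data.List.Relation.Binary.Subset.Propositional using () renaming (_⊆_ to _⊆ₗ_)
open import Data.List.Relation.Unary.Any using (here; there)
open import Data.List.Relation.Unary.Any.Properties using (map⁺; mapMaybe⁺)
open import Data.Maybe.Base as Maybe using ()
open import Data.Maybe.Relation.Unary.Any as MAny using ()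
open import Data.Nat.Base using (ℕ; suc)
open import Data.Nat.Properties using (⊓-assoc; ⊓-comm; ⊓-sel; ⊔-assoc; ⊔-comm; ⊔-sel)
open import Data.Product.Base using (_×_; _,_; ∃; proj₁)
open import Data.Sum.Base using (inj₁; inj₂; reduce)
open import Function.Base using (id; _∘_)
open import Induction.WellFounded using (Acc; acc)
open import Relation.Binary.PropositionalEquality
  using (_≡_; refl; sym; trans; cong; subst; module ≡-Reasoning)
open import Relation.Nullary using (¬_; Dec; yes; no; contradiction)
open import Relation.Nullary.Decidable using (dec⇒maybe; decidable-stable)
open import Relation.Unary using (_∈_; _∉_; _⊆_; _≐_)
open import Relation.Unary.Properties using (≐-sym; ≐-trans)

module _ {A : Set} {_∙_ : A → A → A} (assoc : Associative _≡_ _∙_)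
         (comm : Commutative _≡_ _∙_) (sel : Selective _≡_ _∙_) where

  foldr₁-∈ : ∀ x xs → foldr₁ _∙_ (x ∷⁺ xs) ∈ₗ x ∷ xs
  foldr₁-∈ x []       = here refl
  foldr₁-∈ x (y ∷ ys) with sel x (foldr₁ _∙_ (y ∷⁺ ys))
  ... | inj₁ eq = here eq
  ... | inj₂ eq = there (subst (_∈ₗ y ∷ ys) (sym eq) (foldr₁-∈ y ys))

  -- Reading `a ∙ z ≡ a` as "`a` is at least as good as `z`", this makes the fold the optimum of the
  -- list. Idempotence comes from selectivity at equal arguments.
  foldr₁-absorbs-∈ : ∀ x xs {z} → z ∈ₗ x ∷ xs →
    foldr₁ _∙_ (x ∷⁺ xs) ∙ z ≡ foldr₁ _∙_ (x ∷⁺ xs)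
  foldr₁-absorbs-∈ x []       (here refl) = reduce (sel x x)
  foldr₁-absorbs-∈ x (y ∷ ys) (here refl) = begin
    (x ∙ r) ∙ x  ≡⟨ comm (x ∙ r) x ⟩
    x ∙ (x ∙ r)  ≡⟨ assoc x x r ⟨
    (x ∙ x) ∙ r  ≡⟨ cong (_∙ r) (reduce (sel x x)) ⟩
    x ∙ r        ∎
    where
    open ≡-Reasoning
    r = foldr₁ _∙_ (y ∷⁺ ys)
  foldr₁-absorbs-∈ x (y ∷ ys) (there z∈)  =
    trans (assoc x _ _) (cong (x ∙_) (foldr₁-absorbs-∈ y ys z∈))

  -- Each fold is a member of the other list, so each absorbs the other, and commutativity
  -- identifies them.
  foldr₁-cong-⊆ : ∀ x xs y ys → x ∷ xs ⊆ₗ y ∷ ys → y ∷ ys ⊆ₗ x ∷ xs →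
    foldr₁ _∙_ (x ∷⁺ xs) ≡ foldr₁ _∙_ (y ∷⁺ ys)
  foldr₁-cong-⊆ x xs y ys xs⊆ys ys⊆xs = begin
    a      ≡⟨ foldr₁-absorbs-∈ x xs (ys⊆xs (foldr₁-∈ y ys)) ⟨
    a ∙ b  ≡⟨ comm a b ⟩
    b ∙ a  ≡⟨ foldr₁-absorbs-∈ y ys (xs⊆ys (foldr₁-∈ x xs)) ⟩
    b      ∎
    where
    open ≡-Reasoning
    a = foldr₁ _∙_ (x ∷⁺ xs)
    b = foldr₁ _∙_ (y ∷⁺ ys)

map-⊆ : ∀ {A B C : Set} {f : A → C} {g : B → C} {xs ys} →
  (∀ {x} → x ∈ₗ xs → ∃ λ y → y ∈ₗ ys × f x ≡ g y) → map f xs ⊆ₗ map g ys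
map-⊆ {f = f} {g} match z∈ with ∈-map⁻ f z∈
... | x , x∈ , refl with match x∈
... | y , y∈ , eq = subst (_∈ₗ _) (sym eq) (∈-map⁺ g y∈)

module _ {n : ℕ} (G : Graph n) where
  open Graph G using (adj-sym)

  -- Mutual inclusion is the right hypothesis because several domination moves may be matched with
  -- one Z-move, so the lists of outcomes can differ in length and order.
  optimum-cong-⊆ : ∀ {V W} p {ks ls} → ks ⊆ₗ ls → ls ⊆ₗ ks →
    Game.optimum G V p ks ≡ Game.optimum G W p ls
  optimum-cong-⊆ p {[]}     {[]}     _     _     = refl
  optimum-cong-⊆ p {[]}     {l ∷ ls} _     ls⊆ks with () ← ls⊆ks (here refl)
  optimum-cong-⊆ p {k ∷ ks} {[]}     ks⊆ls _     with () ← ks⊆ls (here refl)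
  optimum-cong-⊆ dominator {k ∷ ks} {l ∷ ls} ks⊆ls ls⊆ks =
    cong suc (foldr₁-cong-⊆ ⊓-assoc ⊓-comm ⊓-sel k ks l ls ks⊆ls ls⊆ks)
  optimum-cong-⊆ staller   {k ∷ ks} {l ∷ ls} ks⊆ls ls⊆ks =
    cong suc (foldr₁-cong-⊆ ⊔-assoc ⊔-comm ⊔-sel k ks l ls ks⊆ls ls⊆ks)

  module _ (V : Variant) where
    open Game G V

    -- The list stores the legality proof found by `legal?`, whose witness may differ from the given
    -- one; hence the existential over `l`.
    legalMoves-complete : ∀ {h v} → Legal h v → ∃ λ l → (v , l) ∈ₗ legalMoves h
    legalMoves-complete {h} {v} l = witness (find (mapMaybe⁺ _ (allFin n)
        (map⁺ (lose (∈-allFin v) (listed (legal? h v))))))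
      where
      listed : (d : Dec (Legal h v)) →
        MAny.Any (λ m → proj₁ m ≡ v) (Maybe.map (v ,_) (dec⇒maybe d))
      listed (yes _) = MAny.just refl
      listed (no ¬l) = contradiction l ¬l

      witness : (∃ λ m → m ∈ₗ legalMoves h × proj₁ m ≡ v) →
        ∃ λ l → (v , l) ∈ₗ legalMoves h
      witness ((_ , l′) , m∈ , refl) = l′ , m∈

  module γ = Game G domination
  module Z = Game G Z-domination

  Legal-Z⇒γ : ∀ h {v} → Z.Legal h v → γ.Legal h v
  Legal-Z⇒γ h (u , u∈ , u∉) = u , inj₁ u∈ , u∉

  Legal-resp-≐ : ∀ {V h h′ v} → Game.Dominated G V h ≐ Game.Dominated G V h′ →
    Game.Legal G V h v → Game.Legal G V h′ v
  Legal-resp-≐ (_ , h′⊆h) (u , u∈ , u∉) = u , u∈ , u∉ ∘ h′⊆h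

  Dominated-∷-mono : ∀ {h h′ v} → γ.Dominated h ⊆ γ.Dominated h′ →
    γ.Dominated (v ∷ h) ⊆ γ.Dominated (v ∷ h′)
  Dominated-∷-mono h⊆h′ (here u∈)  = here u∈
  Dominated-∷-mono h⊆h′ (there u∈) = there (h⊆h′ u∈)

  Dominated-∷-cong : ∀ {h h′ v} → γ.Dominated h ≐ γ.Dominated h′ →
    γ.Dominated (v ∷ h) ≐ γ.Dominated (v ∷ h′)
  Dominated-∷-cong (⊆ , ⊇) = Dominated-∷-mono ⊆ , Dominated-∷-mono ⊇

  module _ {h v w} (v∉ : v ∉ γ.Dominated h) (Nv⊆ : N G v ⊆ γ.Dominated h)
           (w∈Nv : w ∈ N G v) (¬claw : ¬ ClawCenter G w) where

    undominated-neighbour-unique : ∀ {u} → u ∈ N G w → u ∉ γ.Dominated h → u ≡ v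
    undominated-neighbour-unique {u} u∈Nw u∉ with find (Nv⊆ w∈Nv)
    -- Here `w` itself was played, which would have dominated `v`.
    ... | x , x∈h , inj₂ refl = contradiction (lose x∈h (inj₁ (adj-sym w∈Nv))) v∉
    ... | x , x∈h , inj₁ x~w  = decidable-stable (u ≟ v) λ u≢v →
      -- The played vertex `x` dominates itself and its neighbours, so it is distinct from and
      -- non-adjacent to `u` and `v`; `v` and `u` are non-adjacent because every neighbour of `v` is
      -- dominated.
      ¬claw (v , u , x , (adj-sym w∈Nv , u∈Nw , adj-sym x~w)
        , (u≢v ∘ sym
          , (λ { refl → u∉ (lose x∈h (inj₂ refl)) })
          , (λ { refl → v∉ (lose x∈h (inj₂ refl)) }))
        , (λ v~u → u∉ (Nv⊆ v~u))
        , (λ u~x → u∉ (lose x∈h (inj₁ (adj-sym u~x))))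
        , (λ v~x → v∉ (lose x∈h (inj₁ (adj-sym v~x)))))

    Dominated-neighbour≐ : γ.Dominated (w ∷ h) ≐ γ.Dominated (v ∷ h)
    Dominated-neighbour≐ = to , from
      where
      to : γ.Dominated (w ∷ h) ⊆ γ.Dominated (v ∷ h)
      to (there u∈)               = there u∈
      to (here (inj₂ refl))       = here (inj₁ w∈Nv)
      to {u} (here (inj₁ u∈Nw)) with γ.dominated? h u
      ... | yes u∈ = there u∈
      ... | no u∉  = here (inj₂ (sym (undominated-neighbour-unique u∈Nw u∉)))

      from : γ.Dominated (v ∷ h) ⊆ γ.Dominated (w ∷ h)
      from (there u∈)         = there u∈
      from (here (inj₁ u∈Nv)) = there (Nv⊆ u∈Nv)
      from (here (inj₂ refl)) = here (inj₁ (adj-sym w∈Nv))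

  module _ (wcf : WeaklyClawFree G) where

    γ-move⇒Z-move : ∀ h {v} → γ.Legal h v →
      ∃ λ w → Z.Legal h w × γ.Dominated (w ∷ h) ≐ γ.Dominated (v ∷ h)
    γ-move⇒Z-move h {v} (u , u∈ , u∉) with Z.legal? h v
    ... | yes l = v , l , id , id
    ... | no ¬l with u∈
    ... | inj₁ u∈Nv = contradiction (u , u∈Nv , u∉) ¬l
    ... | inj₂ refl =
      let w , w∈Nv , ¬claw = wcf v
          Nv⊆ : N G v ⊆ γ.Dominated h
          Nv⊆ {x} x∈ = decidable-stable (γ.dominated? h x) λ x∉ → ¬l (x , x∈ , x∉)
      in w , (v , adj-sym w∈Nv , u∉) , Dominated-neighbour≐ {h} u∉ Nv⊆ w∈Nv ¬claw

    -- Replacing `v` by `w` makes the histories diverge, so the induction keeps only their dominated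
    -- sets equal. `Dominated` does not depend on the variant, so `γ.Dominated` serves both games.
    -- Arbitrary accessibility proofs allow any legality proofs in the recursive calls.
    value-≡ : ∀ p {h h′} (a : Acc Z._⋖_ h) (a′ : Acc γ._⋖_ h′) →
      γ.Dominated h ≐ γ.Dominated h′ → Z.value p h a ≡ γ.value p h′ a′
    value-≡ p {h} {h′} (acc rs) (acc rs′) h≐h′ =
      optimum-cong-⊆ {Z-domination} {domination} p (map-⊆ Z⇒γ) (map-⊆ γ⇒Z)
      where
      Z⇒γ : ∀ {m} → m ∈ₗ Z.legalMoves h → _
      Z⇒γ {v , l} _ =
        let l′ , m∈ = legalMoves-complete domination
                        (Legal-resp-≐ {domination} {h} {h′} h≐h′ (Legal-Z⇒γ h l))
        in (v , l′) , m∈ , value-≡ (opponent p) (rs _) (rs′ _) (Dominated-∷-cong h≐h′)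

      γ⇒Z : ∀ {m} → m ∈ₗ γ.legalMoves h′ → _
      γ⇒Z {v , l′} _ =
        -- The move is first transported to `h`, where its Z-substitute must be legal.
        let w , l , w≐v = γ-move⇒Z-move h (Legal-resp-≐ {domination} {h′} {h} (≐-sym h≐h′) l′)
            l″ , m∈ = legalMoves-complete Z-domination l
        in (w , l″) , m∈ , sym (value-≡ (opponent p) (rs _) (rs′ _)
             (≐-trans w≐v (Dominated-∷-cong h≐h′)))

    gameNumber-≡ : ∀ p → Z.gameNumber p ≡ γ.gameNumber p
    gameNumber-≡ p = value-≡ p (Z.⋖-wellFounded []) (γ.⋖-wellFounded []) (id , id)

theorem4p2 : ∀ (n : ℕ) (G : Graph n) → WeaklyClawFree G →
    (γZg G ≡ γg G) × (γZg′ G ≡ γg′ G)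
theorem4p2 n G wcf = gameNumber-≡ G wcf dominator , gameNumber-≡ G wcf staller
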